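{- Let $U$ be a model of $\mathrm{ZFCU}_{\mathrm{R}}$. The following are equivalent: (1) the Łoś theorem holds for all internal ultrapowers of $U$; (2) $U\models$ Collection.
   Context: The language of urelement set theory has $\in$ and a unary predicate $\mathcal{A}$ for urelements. $\mathrm{ZFCU}_{\mathrm{R}}$ = ZU (urelements have no members, Extensionality for sets, Foundation, Pairing, Union, Powerset, Infinity, Separation scheme) + Replacement scheme + AC. Collection: for every formula $\varphi$, $\forall w,u(\forall x\in w\,\exists y\,\varphi(x,y,u)\to\exists v\,\forall x\in w\,\exists y\in v\,\varphi(x,y,u))$. Internal ultrapower: given $F,x\in U$ with $U\models$ "$F$ is an ultrafilter on $x$", for $f,g\in U$ that $U$ thinks are functions on $x$ put $f=_Fg$ iff $U\models\{y\in x:f(y)=g(y)\}\in F$; $[f]$ is the $=_F$-class of $f$, $U/F$ the set of all such classes, $[g]\hat\in[f]$ iff $U\models\{y\in x:g(y)\in f(y)\}\in F$, and $\hat{\mathcal{A}}([f])$ iff $U\models\{y\in x:\mathcal{A}(f(y))\}\in F$. The Łoś theorem holds for $U/F$ if for every formula $\varphi$ and $[f_1],\dots,[f_n]$, $U/F\models\varphi([f_1],\dots,[f_n])$ iff $U\models\{y\in x:\varphi(f_1(y),\dots,f_n(y))\}\in F$. -}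

module Defs where

open import Data.Nat using (ℕ; zero; suc)
open import Data.Fin using (Fin)
open import Data.Vec.Functional using (_∷_)
open import Data.Product using (Σ; ∃; _×_; _,_; proj₁)
open import Data.Sum using (_⊎_)
open import Data.Empty using (⊥)
open import Relation.Nullary using (¬_)
open import Relation.Binary.PropositionalEquality using (_≡_)
open import Function.Bundles using (_⇔_)

data Formula (n : ℕ) : Set where
  meṁ  : Fin n → Fin n → Formula n
  eq̇   : Fin n → Fin n → Formula n
  uṙ   : Fin n → Formula n
  ⊥̇    : Formula n
  ¬̇_   : Formula n → Formula n
  _∧̇_  : Formula n → Formula n → Formula n
  _∨̇_  : Formula n → Formula n → Formula n
  _⇒̇_  : Formula n → Formula n → Formula n
  ∀̇    : Formula (suc n) → Formula n    -- binds variable 0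
  ∃̇    : Formula (suc n) → Formula n

-- Structures (equality interpreted by a relation _≈_, so that
-- quotient structures such as ultrapowers can be presented as setoids).

record Structure : Set₁ where
  field
    Carrier : Set
    _≈_     : Carrier → Carrier → Set
    _∈_     : Carrier → Carrier → Set
    𝒜       : Carrier → Set

module _ (S : Structure) where
  open Structure S

  -- Tarskian satisfaction (metatheory assumed classical in the theorem)
  Sat : ∀ {n} → Formula n → (Fin n → Carrier) → Set
  Sat (meṁ i j) ρ = ρ i ∈ ρ j
  Sat (eq̇ i j)  ρ = ρ i ≈ ρ j
  Sat (uṙ i)    ρ = 𝒜 (ρ i)
  Sat ⊥̇         ρ = ⊥
  Sat (¬̇ φ)     ρ = ¬ Sat φ ρ
  Sat (φ ∧̇ ψ)   ρ = Sat φ ρ × Sat ψ ρ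
  Sat (φ ∨̇ ψ)   ρ = Sat φ ρ ⊎ Sat ψ ρ
  Sat (φ ⇒̇ ψ)   ρ = Sat φ ρ → Sat ψ ρ
  Sat (∀̇ φ)     ρ = ∀ a → Sat φ (a ∷ ρ)
  Sat (∃̇ φ)     ρ = ∃ λ a → Sat φ (a ∷ ρ)

-- A candidate model U of urelement set theory: equality is genuine
-- equality _≡_ on the carrier.

record UStructure : Set₁ where
  field
    M   : Set
    _∈_ : M → M → Set
    𝒜   : M → Set

toStructure : UStructure → Structure
toStructure U = record
  { Carrier = M ; _≈_ = _≡_ ; _∈_ = _∈_ ; 𝒜 = 𝒜 }
  where open UStructure U

_↔_ : Set → Set → Set
A ↔ B = (A → B) × (B → A)

module _ (U : UStructure) where
  open UStructure U

  private
    US = toStructure U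

  IsSet : M → Set
  IsSet a = ¬ 𝒜 a

  SubsetOf : M → M → Set
  SubsetOf s x = ∀ z → z ∈ s → z ∈ x

  IsDoubleton : M → M → M → Set
  IsDoubleton z a b = ∀ w → (w ∈ z) ↔ ((w ≡ a) ⊎ (w ≡ b))

  -- p = (a , b) = {{a},{a,b}}  (Kuratowski pair)
  IsOPair : M → M → M → Set
  IsOPair p a b = ∀ z → (z ∈ p) ↔ (IsDoubleton z a a ⊎ IsDoubleton z a b)

  -- (a , b) ∈ r ; for a function f this says f(a) = b
  RelHolds : M → M → M → Set
  RelHolds r a b = ∃ λ p → (p ∈ r) × IsOPair p a b

  IsFunctionOn : M → M → Set
  IsFunctionOn f x =
      IsSet f
    × (∀ p → p ∈ f → ∃ λ a → ∃ λ b → (a ∈ x) × IsOPair p a b)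
    × (∀ a → a ∈ x → ∃ λ b → RelHolds f a b)
    × (∀ a b c → RelHolds f a b → RelHolds f a c → b ≡ c)

  IsUltrafilterOn : M → M → Set
  IsUltrafilterOn F x =
      (∀ s → s ∈ F → IsSet s × SubsetOf s x)
    × (x ∈ F)
    × (∀ s → s ∈ F → ∃ λ z → z ∈ s)
    × (∀ s t u → s ∈ F → t ∈ F → IsSet u →
         (∀ z → (z ∈ u) ↔ ((z ∈ s) × (z ∈ t))) → u ∈ F)
    × (∀ s t → s ∈ F → IsSet t → SubsetOf t x → SubsetOf s t → t ∈ F)
    × (∀ s → IsSet s → SubsetOf s x →
         (s ∈ F) ⊎ (∀ t → IsSet t → (∀ z → (z ∈ t) ↔ ((z ∈ x) × ¬ (z ∈ s))) → t ∈ F))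

  InF : M → M → (M → Set) → Set
  InF F x P = ∃ λ s → (s ∈ F) × (∀ y → (y ∈ s) ↔ ((y ∈ x) × P y))

  WellOrders : M → M → Set
  WellOrders r w =
      (∀ a → a ∈ w → ¬ RelHolds r a a)
    × (∀ a b c → a ∈ w → b ∈ w → c ∈ w →
         RelHolds r a b → RelHolds r b c → RelHolds r a c)
    × (∀ a b → a ∈ w → b ∈ w → RelHolds r a b ⊎ (a ≡ b) ⊎ RelHolds r b a)
    × (∀ s → SubsetOf s w → (∃ λ z → z ∈ s) →
         ∃ λ m → (m ∈ s) × (∀ z → z ∈ s → ¬ RelHolds r z m))

  Collection : Set
  Collection = ∀ {n} (φ : Formula (suc (suc n))) (ρ : Fin n → M) (w : M) →
    (∀ x → x ∈ w → ∃ λ y → Sat US φ (x ∷ y ∷ ρ)) →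
    ∃ λ v → ∀ x → x ∈ w → ∃ λ y → (y ∈ v) × Sat US φ (x ∷ y ∷ ρ)

  record IsZFCUR : Set where
    field
      urelementsEmpty : ∀ a → 𝒜 a → ∀ z → ¬ (z ∈ a)
      extensionality  : ∀ a b → IsSet a → IsSet b →
                          (∀ z → (z ∈ a) ↔ (z ∈ b)) → a ≡ b
      foundation      : ∀ a → (∃ λ z → z ∈ a) →
                          ∃ λ z → (z ∈ a) × (∀ w → w ∈ z → ¬ (w ∈ a))
      pairing         : ∀ a b → ∃ λ c → IsSet c × IsDoubleton c a b
      union           : ∀ a → ∃ λ c → IsSet c ×
                          (∀ z → (z ∈ c) ↔ (∃ λ w → (w ∈ a) × (z ∈ w)))
      powerset        : ∀ a → ∃ λ c → IsSet c ×
                          (∀ z → (z ∈ c) ↔ (IsSet z × SubsetOf z a))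
      infinity        : ∃ λ c → IsSet c
                          × (∃ λ e → (e ∈ c) × IsSet e × (∀ w → ¬ (w ∈ e)))
                          × (∀ z → z ∈ c → ∃ λ s → (s ∈ c) × IsSet s ×
                               (∀ w → (w ∈ s) ↔ ((w ∈ z) ⊎ (w ≡ z))))
      separation      : ∀ {n} (φ : Formula (suc n)) (ρ : Fin n → M) (a : M) →
                          ∃ λ c → IsSet c ×
                            (∀ z → (z ∈ c) ↔ ((z ∈ a) × Sat US φ (z ∷ ρ)))
      replacement     : ∀ {n} (φ : Formula (suc (suc n))) (ρ : Fin n → M) (w : M) →
                          (∀ x → x ∈ w → ∃ λ y → Sat US φ (x ∷ y ∷ ρ) ×
                             (∀ y′ → Sat US φ (x ∷ y′ ∷ ρ) → y′ ≡ y)) →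
                          ∃ λ v → ∀ x → x ∈ w → ∃ λ y → (y ∈ v) × Sat US φ (x ∷ y ∷ ρ)
      choice          : ∀ w → IsSet w → ∃ λ r → WellOrders r w

  Ult : M → M → Structure
  Ult F x = record
    { Carrier = Σ M (λ f → IsFunctionOn f x)
    ; _≈_ = λ f g → InF F x (λ y → ∃ λ b →
              RelHolds (proj₁ f) y b × RelHolds (proj₁ g) y b)
    ; _∈_ = λ g f → InF F x (λ y → ∃ λ b → ∃ λ c →
              RelHolds (proj₁ g) y b × RelHolds (proj₁ f) y c × (b ∈ c))
    ; 𝒜 = λ f → InF F x (λ y → ∃ λ b → RelHolds (proj₁ f) y b × 𝒜 b)
    }

  LosHolds : M → M → Set
  LosHolds F x = ∀ {n} (φ : Formula n)
    (ρ : Fin n → Structure.Carrier (Ult F x)) →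
    Sat (Ult F x) φ ρ ⇔
    InF F x (λ y → ∃ λ (b : Fin n → M) →
      (∀ i → RelHolds (proj₁ (ρ i)) y (b i)) × Sat US φ b)

  LosForAllInternalUltrapowers : Set
  LosForAllInternalUltrapowers = ∀ F x → IsUltrafilterOn F x → LosHolds F x

{-# OPTIONS --safe #-}

-- Collection gives Łoś by the usual induction on formulas; the existential step collects candidate
-- witnesses into a set, well-orders it and takes the least one in each coordinate.
--
-- Conversely, well-order w and show by induction on b ∈ w that some v collects witnesses for all c ≼ b.
-- On the initial segment x below b, take an ultrafilter F on x containing every tail {c : a ≼ c}.
-- "Some v collects witnesses up to y" holds at every y ∈ x, so by Łoś some g satisfies it at F-almost
-- every y, and as every c ∈ x lies below F-almost every y, the union of the values of g collects for
-- all of x.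
--
-- F comes from a greedy recursion along a well-order of the subsets of x: a subset is accepted iff some
-- filter contains it together with the tails and everything accepted earlier.

module Submission where

open import Defs
open import Level using (0ℓ)
open import Axiom.ExcludedMiddle using (ExcludedMiddle)
open import Function.Base using (id; _∘_)
open import Function.Bundles using (_⇔_; mk⇔; Equivalence)
open import Data.Nat using (ℕ; zero; suc; _+_)
open import Data.Fin using (Fin; zero; suc; _↑ˡ_; _↑ʳ_)
open import Data.Vec.Functional using (_∷_; []; _++_)
open import Data.Vec.Functional.Properties using (lookup-++ˡ; lookup-++ʳ)
open import Data.Product using (Σ; ∃; _×_; _,_; proj₁; proj₂; map₂)
open import Data.Sum using (_⊎_; inj₁; inj₂; [_,_])
import Data.Sum as Sum
open import Data.Empty using (⊥; ⊥-elim)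
open import Data.Unit using (⊤; tt)
open import Relation.Nullary using (¬_; yes; no)
open import Relation.Binary.PropositionalEquality
  using (_≡_; refl; sym; trans; cong; subst)

-- Congruence of bi-implication under connectives and quantifiers.

↔-trans : ∀ {A B C : Set} → A ↔ B → B ↔ C → A ↔ C
↔-trans (f , g) (h , k) = h ∘ f , g ∘ k

↔-sym : ∀ {A B : Set} → A ↔ B → B ↔ A
↔-sym (f , g) = g , f

∧-cong : ∀ {A B C D : Set} → A ↔ C → B ↔ D → (A × B) ↔ (C × D)
∧-cong (f , g) (h , k) = (λ (a , b) → f a , h b) , (λ (c , d) → g c , k d)

∨-cong : ∀ {A B C D : Set} → A ↔ C → B ↔ D → (A ⊎ B) ↔ (C ⊎ D)
∨-cong (f , g) (h , k) = Sum.map f h , Sum.map g k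

⇒-cong : ∀ {A B C D : Set} → A ↔ C → B ↔ D → (A → B) ↔ (C → D)
⇒-cong (f , g) (h , k) = (λ p → h ∘ p ∘ g) , (λ p → k ∘ p ∘ f)

∃-cong : ∀ {A : Set} {B C : A → Set} → (∀ a → B a ↔ C a) → ∃ B ↔ ∃ C
∃-cong e = (λ (a , b) → a , proj₁ (e a) b) , (λ (a , c) → a , proj₂ (e a) c)

∀-cong : ∀ {A : Set} {B C : A → Set} → (∀ a → B a ↔ C a) → (∀ a → B a) ↔ (∀ a → C a)
∀-cong e = (λ p a → proj₁ (e a) (p a)) , (λ p a → proj₂ (e a) (p a))

-- Renaming of variables

lift : ∀ {n m} → (Fin n → Fin m) → Fin (suc n) → Fin (suc m)
lift σ zero    = zero
lift σ (suc i) = suc (σ i)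

ren : ∀ {n m} → (Fin n → Fin m) → Formula n → Formula m
ren σ (meṁ i j) = meṁ (σ i) (σ j)
ren σ (eq̇ i j)  = eq̇ (σ i) (σ j)
ren σ (uṙ i)    = uṙ (σ i)
ren σ ⊥̇         = ⊥̇
ren σ (¬̇ φ)     = ¬̇ ren σ φ
ren σ (φ ∧̇ ψ)   = ren σ φ ∧̇ ren σ ψ
ren σ (φ ∨̇ ψ)   = ren σ φ ∨̇ ren σ ψ
ren σ (φ ⇒̇ ψ)   = ren σ φ ⇒̇ ren σ ψ
ren σ (∀̇ φ)     = ∀̇ (ren (lift σ) φ)
ren σ (∃̇ φ)     = ∃̇ (ren (lift σ) φ)

module _ (S : Structure) where
  open Structure S

  -- Environments are compared pointwise: under a binder, `(a ∷ ρ) ∘ lift σ` and `a ∷ (ρ ∘ σ)` agree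
  -- at every index but are not definitionally the same function.
  Sat-ren : ∀ {n m} (φ : Formula n) {σ : Fin n → Fin m} {ρ : Fin m → Carrier} {ρ′ : Fin n → Carrier} →
            (∀ i → ρ (σ i) ≡ ρ′ i) → Sat S (ren σ φ) ρ ↔ Sat S φ ρ′
  Sat-ren-∷ : ∀ {n m} (φ : Formula (suc n)) {σ : Fin n → Fin m} {ρ : Fin m → Carrier} {ρ′ : Fin n → Carrier} →
              (∀ i → ρ (σ i) ≡ ρ′ i) → ∀ a → Sat S (ren (lift σ) φ) (a ∷ ρ) ↔ Sat S φ (a ∷ ρ′)

  Sat-ren (meṁ i j) e rewrite e i | e j = id , id
  Sat-ren (eq̇ i j)  e rewrite e i | e j = id , id
  Sat-ren (uṙ i)    e rewrite e i = id , id
  Sat-ren ⊥̇         e = id , id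
  Sat-ren (¬̇ φ)     e = ⇒-cong (Sat-ren φ e) (id , id)
  Sat-ren (φ ∧̇ ψ)   e = ∧-cong (Sat-ren φ e) (Sat-ren ψ e)
  Sat-ren (φ ∨̇ ψ)   e = ∨-cong (Sat-ren φ e) (Sat-ren ψ e)
  Sat-ren (φ ⇒̇ ψ)   e = ⇒-cong (Sat-ren φ e) (Sat-ren ψ e)
  Sat-ren (∀̇ φ)     e = ∀-cong (Sat-ren-∷ φ e)
  Sat-ren (∃̇ φ)     e = ∃-cong (Sat-ren-∷ φ e)

  Sat-ren-∷ φ e a = Sat-ren φ λ { zero → refl ; (suc i) → e i }

  -- Both sides are equivalent to `ren id φ` at `ρ`, which spares a second induction on formulas.
  Sat-cong : ∀ {n} (φ : Formula n) {ρ ρ′ : Fin n → Carrier} →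
             (∀ i → ρ i ≡ ρ′ i) → Sat S φ ρ ↔ Sat S φ ρ′
  Sat-cong φ e = ↔-trans (↔-sym (Sat-ren φ {σ = id} λ _ → refl)) (Sat-ren φ e)

module Definability (U : UStructure) where
  open UStructure U

  private
    S = toStructure U

  -- Contexts are nested pairs rather than functions Fin k → M, so that unification can read
  -- a predicate off a goal when the combinators below go under a binder.

  Env : ℕ → Set
  Env zero    = ⊤
  Env (suc k) = Env k × M

  env : ∀ {k n} → Env k → (Fin n → M) → Fin (k + n) → M
  env {zero}  _       ρ = ρ
  env {suc k} (v , a) ρ = a ∷ env v ρ

  get : ∀ {k} → Env k → Fin k → M
  get {suc k} (v , a) zero    = a
  get {suc k} (v , a) (suc i) = get v i

  pull : ∀ {k l} → (Fin k → Fin l) → Env l → Env k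
  pull {zero}  θ w = tt
  pull {suc k} θ w = pull (θ ∘ suc) w , get w (θ zero)

  pull-suc : ∀ {k l} (θ : Fin k → Fin l) w a → pull (suc ∘ θ) (w , a) ≡ pull θ w
  pull-suc {zero}  θ w a = refl
  pull-suc {suc k} θ w a = cong (_, get w (θ zero)) (pull-suc (θ ∘ suc) w a)

  pull-id : ∀ {k} (w : Env k) → pull id w ≡ w
  pull-id {zero}  w       = refl
  pull-id {suc k} (w , a) = cong (_, a) (trans (pull-suc id w a) (pull-id w))

  env-get : ∀ {k n} (w : Env k) (ρ : Fin n → M) i → env w ρ (i ↑ˡ n) ≡ get w i
  env-get {suc k} (w , a) ρ zero    = refl
  env-get {suc k} (w , a) ρ (suc i) = env-get w ρ i

  env-par : ∀ {k n} (w : Env k) (ρ : Fin n → M) i → env w ρ (k ↑ʳ i) ≡ ρ i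
  env-par {zero}  w       ρ i = refl
  env-par {suc k} (w , a) ρ i = env-par w ρ i

  reindex : ∀ {k l n m} → (Fin k → Fin l) → (Fin n → Fin m) → Fin (k + n) → Fin (l + m)
  reindex {zero}  {l}     θ τ i       = l ↑ʳ τ i
  reindex {suc k} {m = m} θ τ zero    = θ zero ↑ˡ m
  reindex {suc k}         θ τ (suc i) = reindex (θ ∘ suc) τ i

  env-reindex : ∀ {k l n m} (θ : Fin k → Fin l) (τ : Fin n → Fin m) {ρ : Fin n → M} {ρ′ : Fin m → M} →
                (∀ i → ρ′ (τ i) ≡ ρ i) → ∀ w i → env w ρ′ (reindex θ τ i) ≡ env (pull θ w) ρ i
  env-reindex {zero}  θ τ {ρ′ = ρ′} e w i       = trans (env-par w ρ′ (τ i)) (e i)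
  env-reindex {suc k} θ τ {ρ′ = ρ′} e w zero    = env-get w ρ′ (θ zero)
  env-reindex {suc k} θ τ           e w (suc i) = env-reindex (θ ∘ suc) τ e w i

  -- Definability with parameters from M

  -- Arguments are carried out with Agda predicates; a `Def` certifies that such a predicate is
  -- first-order over `U`, which is what the axiom schemes require. Only the `k` context entries
  -- vary; `params` stays fixed.
  record Def {k : ℕ} (P : Env k → Set) : Set where
    constructor def
    field
      {arity} : ℕ
      params  : Fin arity → M
      formula : Formula (k + arity)
      correct : ∀ v → Sat S formula (env v params) ↔ P v
  open Def public

  abstract
    Def-resp : ∀ {k} {P Q : Env k → Set} → (∀ v → P v ↔ Q v) → Def P → Def Q
    Def-resp e (def ρ φ c) = def ρ φ λ v → ↔-trans (c v) (e v)

    Def-pull : ∀ {k l} {P : Env k → Set} (θ : Fin k → Fin l) → Def P → Def (P ∘ pull θ)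
    Def-pull θ (def ρ φ c) = def ρ (ren (reindex θ id) φ)
      λ w → ↔-trans (Sat-ren S φ (env-reindex θ id (λ _ → refl) w)) (c (pull θ w))

  -- Two definitions come with different parameter vectors. Before they are joined by a connective,
  -- each formula is moved to the concatenated vector.
  reparam : ∀ {k n m} (φ : Formula (k + n)) (τ : Fin n → Fin m) {ρ : Fin n → M} {ρ′ : Fin m → M} →
            (∀ i → ρ′ (τ i) ≡ ρ i) → (v : Env k) →
            Sat S (ren (reindex {k} id τ) φ) (env v ρ′) ↔ Sat S φ (env v ρ)
  reparam {k} φ τ {ρ} e v = ↔-trans (Sat-ren S φ (env-reindex id τ e v))
    (Sat-cong S φ λ i → cong (λ w → env {k} w ρ i) (pull-id v))

  module _ (_⊙_ : ∀ {n} → Formula n → Formula n → Formula n) (_⊛_ : Set → Set → Set)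
           (⊙-sat : ∀ {n} {φ ψ : Formula n} {ρ : Fin n → M} {A B : Set} →
                    Sat S φ ρ ↔ A → Sat S ψ ρ ↔ B → Sat S (φ ⊙ ψ) ρ ↔ (A ⊛ B)) where

    abstract
      connectiveᵈ : ∀ {k} {P Q : Env k → Set} → Def P → Def Q → Def (λ v → P v ⊛ Q v)
      connectiveᵈ {k} (def {m} ρ φ c) (def {n} ρ′ ψ c′) =
        def (ρ ++ ρ′) (ren (reindex {k} id (_↑ˡ n)) φ ⊙ ren (reindex {k} id (m ↑ʳ_)) ψ) λ v →
          ⊙-sat (↔-trans (reparam φ (_↑ˡ n) (lookup-++ˡ ρ ρ′) v) (c v))
                (↔-trans (reparam ψ (m ↑ʳ_) (lookup-++ʳ ρ ρ′) v) (c′ v))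

  infixr 3 _∧ᵈ_
  infixr 2 _∨ᵈ_
  infixr 1 _⇒ᵈ_

  abstract
    _∧ᵈ_ : ∀ {k} {P Q : Env k → Set} → Def P → Def Q → Def (λ v → P v × Q v)
    _∧ᵈ_ = connectiveᵈ _∧̇_ _×_ ∧-cong

    _∨ᵈ_ : ∀ {k} {P Q : Env k → Set} → Def P → Def Q → Def (λ v → P v ⊎ Q v)
    _∨ᵈ_ = connectiveᵈ _∨̇_ _⊎_ ∨-cong

    _⇒ᵈ_ : ∀ {k} {P Q : Env k → Set} → Def P → Def Q → Def (λ v → P v → Q v)
    _⇒ᵈ_ = connectiveᵈ _⇒̇_ (λ A B → A → B) ⇒-cong

    ¬ᵈ_ : ∀ {k} {P : Env k → Set} → Def P → Def (λ v → ¬ P v)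
    ¬ᵈ def ρ φ c = def ρ (¬̇ φ) λ v → ⇒-cong (c v) (id , id)

    ⊥ᵈ : ∀ {k} → Def {k} (λ _ → ⊥)
    ⊥ᵈ = def [] ⊥̇ λ _ → id , id

    ∃ᵈ : ∀ {k} {P : Env k → M → Set} → Def {suc k} (λ w → P (proj₁ w) (proj₂ w)) → Def (λ v → ∃ λ a → P v a)
    ∃ᵈ (def ρ φ c) = def ρ (∃̇ φ) λ v → ∃-cong λ a → c (v , a)

    ∀ᵈ : ∀ {k} {P : Env k → M → Set} → Def {suc k} (λ w → P (proj₁ w) (proj₂ w)) → Def (λ v → ∀ a → P v a)
    ∀ᵈ (def ρ φ c) = def ρ (∀̇ φ) λ v → ∀-cong λ a → c (v , a)

  _⇔ᵈ_ : ∀ {k} {P Q : Env k → Set} → Def P → Def Q → Def (λ v → P v ↔ Q v)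
  d ⇔ᵈ e = (d ⇒ᵈ e) ∧ᵈ (e ⇒ᵈ d)

  -- Definable terms

  -- The language has no function symbols, so a term is represented by its definable graph. This
  -- lets values such as `app f y` occur inside formulas.
  record Tm {k : ℕ} (f : Env k → M) : Set where
    constructor tm
    field graph : Def {suc k} (λ w → proj₂ w ≡ f (proj₁ w))
  open Tm public

  abstract
    wk : ∀ {k} {f : Env k → M} → Tm f → Tm {suc k} (λ w → f (proj₁ w))
    wk {f = f} (tm d) = tm (Def-resp
      (λ { ((w , c) , a) → let e = trans (pull-suc suc (w , c) a) (trans (pull-suc id w c) (pull-id w)) in
           (λ p → trans p (cong f e)) , (λ p → trans p (cong f (sym e))) })
      (Def-pull (lift suc) d))

    v0 : ∀ {k} → Tm {suc k} (λ w → proj₂ w)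
    v0 = tm (def [] (eq̇ zero (suc zero)) λ _ → id , id)

    v1 : ∀ {k} → Tm {suc (suc k)} (λ w → proj₂ (proj₁ w))
    v1 = wk v0

    v2 : ∀ {k} → Tm {suc (suc (suc k))} (λ w → proj₂ (proj₁ (proj₁ w)))
    v2 = wk v1

    con : ∀ {k} (a : M) → Tm {k} (λ _ → a)
    con {k} a = tm (def {arity = 1} (λ _ → a) (eq̇ zero (suc k ↑ʳ zero)) λ (v , b) →
      (λ p → trans p (env-par v _ zero)) , (λ p → trans p (sym (env-par v _ zero))))

    -- The term is eliminated through its graph: `P (f v)` is expressed as the existence of an `a`
    -- with `a ≡ f v` and `P a`.
    substᵈ : ∀ {k} {f : Env k → M} {P : M → Set} → Def {suc k} (λ w → P (proj₂ w)) → Tm f → Def (λ v → P (f v))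
    substᵈ {f = f} {P} d s = Def-resp
      (λ v → (λ { (a , refl , p) → p }) , (λ p → f v , refl , p))
      (∃ᵈ {P = λ v a → (a ≡ f v) × P a} (graph s ∧ᵈ d))

    subst₂ᵈ : ∀ {k} {f g : Env k → M} {P : M → M → Set} →
      Def {suc (suc k)} (λ w → P (proj₂ (proj₁ w)) (proj₂ w)) → Tm f → Tm g → Def (λ v → P (f v) (g v))
    subst₂ᵈ {f = f} {g} {P} d s t = Def-resp
      (λ v → (λ { (a , refl , p) → p }) , (λ p → f v , refl , p))
      (∃ᵈ {P = λ v a → (a ≡ f v) × P a (g v)} (graph s ∧ᵈ Def-resp
        (λ w → (λ { (b , refl , p) → p }) , (λ p → g (proj₁ w) , refl , p))
        (∃ᵈ {P = λ w b → (b ≡ g (proj₁ w)) × P (proj₂ w) b} (graph (wk t) ∧ᵈ d))))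

  infix 4 _∈ᵈ_ _≡ᵈ_

  abstract
    _∈ᵈ_ : ∀ {k} {f g : Env k → M} → Tm f → Tm g → Def (λ v → f v ∈ g v)
    _∈ᵈ_ = subst₂ᵈ {P = _∈_} (def [] (meṁ (suc zero) zero) λ _ → id , id)

    _≡ᵈ_ : ∀ {k} {f g : Env k → M} → Tm f → Tm g → Def (λ v → f v ≡ g v)
    _≡ᵈ_ = subst₂ᵈ {P = _≡_} (def [] (eq̇ (suc zero) zero) λ _ → id , id)

    𝒜ᵈ : ∀ {k} {f : Env k → M} → Tm f → Def (λ v → 𝒜 (f v))
    𝒜ᵈ = substᵈ {P = 𝒜} (def [] (uṙ zero) λ _ → id , id)

    -- Makes truth of a fixed formula at coordinates `f₁(y), …, fₙ(y)` definable in `y`, so that the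
    -- sets in the Łoś theorem exist by Separation.
    Satᵈ : ∀ {k m} (φ : Formula m) (f : Fin m → Env k → M) → (∀ i → Tm (f i)) →
           Def (λ v → Sat S φ (λ i → f i v))
    Satᵈ-∷ : ∀ {k m} (φ : Formula (suc m)) (f : Fin m → Env k → M) → (∀ i → Tm (f i)) →
             Def {suc k} (λ w → Sat S φ (proj₂ w ∷ λ i → f i (proj₁ w)))

    Satᵈ (meṁ i j) f t = t i ∈ᵈ t j
    Satᵈ (eq̇ i j)  f t = t i ≡ᵈ t j
    Satᵈ (uṙ i)    f t = 𝒜ᵈ (t i)
    Satᵈ ⊥̇         f t = ⊥ᵈ
    Satᵈ (¬̇ φ)     f t = ¬ᵈ Satᵈ φ f t
    Satᵈ (φ ∧̇ ψ)   f t = Satᵈ φ f t ∧ᵈ Satᵈ ψ f t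
    Satᵈ (φ ∨̇ ψ)   f t = Satᵈ φ f t ∨ᵈ Satᵈ ψ f t
    Satᵈ (φ ⇒̇ ψ)   f t = Satᵈ φ f t ⇒ᵈ Satᵈ ψ f t
    Satᵈ (∀̇ φ)     f t = ∀ᵈ (Satᵈ-∷ φ f t)
    Satᵈ (∃̇ φ)     f t = ∃ᵈ (Satᵈ-∷ φ f t)

    Satᵈ-∷ φ f t = Def-resp (λ w → Sat-cong S φ λ { zero → refl ; (suc i) → refl })
      (Satᵈ φ (λ i w → (proj₂ w ∷ λ j → f j (proj₁ w)) i) λ { zero → v0 ; (suc i) → wk (t i) })

  -- Definability of the basic set-theoretic notions.

  abstract
    IsSetᵈ : ∀ {k} {f : Env k → M} → Tm f → Def (λ v → IsSet U (f v))
    IsSetᵈ t = ¬ᵈ 𝒜ᵈ t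

    SubsetOfᵈ : ∀ {k} {f g : Env k → M} → Tm f → Tm g → Def (λ v → SubsetOf U (f v) (g v))
    SubsetOfᵈ s t = ∀ᵈ (v0 ∈ᵈ wk s ⇒ᵈ v0 ∈ᵈ wk t)

    IsDoubletonᵈ : ∀ {k} {f g h : Env k → M} → Tm f → Tm g → Tm h → Def (λ v → IsDoubleton U (f v) (g v) (h v))
    IsDoubletonᵈ r s t = ∀ᵈ ((v0 ∈ᵈ wk r) ⇔ᵈ (v0 ≡ᵈ wk s ∨ᵈ v0 ≡ᵈ wk t))

    IsOPairᵈ : ∀ {k} {f g h : Env k → M} → Tm f → Tm g → Tm h → Def (λ v → IsOPair U (f v) (g v) (h v))
    IsOPairᵈ r s t = ∀ᵈ ((v0 ∈ᵈ wk r) ⇔ᵈ (IsDoubletonᵈ v0 (wk s) (wk s) ∨ᵈ IsDoubletonᵈ v0 (wk s) (wk t)))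

    RelHoldsᵈ : ∀ {k} {f g h : Env k → M} → Tm f → Tm g → Tm h → Def (λ v → RelHolds U (f v) (g v) (h v))
    RelHoldsᵈ r s t = ∃ᵈ (v0 ∈ᵈ wk r ∧ᵈ IsOPairᵈ v0 (wk s) (wk t))

-- Set theory inside the model.

module SetTheory (em : ExcludedMiddle 0ℓ) (U : UStructure) (Z : IsZFCUR U) where
  open UStructure U
  open IsZFCUR Z
  open Definability U

  private
    S = toStructure U

  dne : ∀ {P : Set} → ¬ ¬ P → P
  dne {P} n with em {P}
  ... | yes p = p
  ... | no ¬p = ⊥-elim (n ¬p)

  ∈⇒IsSet : ∀ {z a} → z ∈ a → IsSet U a
  ∈⇒IsSet {z} {a} z∈a ua = urelementsEmpty a ua z z∈a

  abstract
    comprehension : (P : M → Set) → Def {1} (λ w → P (proj₂ w)) → ∀ a →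
                    ∃ λ c → IsSet U c × (∀ z → (z ∈ c) ↔ ((z ∈ a) × P z))
    comprehension P d a with separation (formula d) (params d) a
    ... | c , sc , h = c , sc , λ z → ↔-trans (h z) (∧-cong (id , id) (correct d (tt , z)))

  -- Ordered pairs

  IsDoubleton-unique : ∀ {z z′ a b} → IsDoubleton U z a b → IsDoubleton U z′ a b → z ≡ z′
  IsDoubleton-unique {z} {z′} {a} h h′ = extensionality z z′
    (∈⇒IsSet (proj₂ (h a) (inj₁ refl))) (∈⇒IsSet (proj₂ (h′ a) (inj₁ refl)))
    λ w → ↔-trans (h w) (↔-sym (h′ w))

  opair : ∀ a b → ∃ λ p → IsOPair U p a b
  opair a b with pairing a a | pairing a b
  ... | s , _ , hs | d , _ , hd with pairing s d
  ... | p , _ , hp = p , λ z → ↔-trans (hp z)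
    ( Sum.map (λ { refl → hs }) (λ { refl → hd })
    , Sum.map (λ h → IsDoubleton-unique h hs) (λ h → IsDoubleton-unique h hd))

  IsOPair-member : ∀ {p a b} → IsOPair U p a b → ∃ λ s → (s ∈ p) × IsDoubleton U s a b
  IsOPair-member {a = a} {b} h with pairing a b
  ... | s , _ , hs = s , proj₂ (h s) (inj₂ hs) , hs

  IsOPair-unique : ∀ {p p′ a b} → IsOPair U p a b → IsOPair U p′ a b → p ≡ p′
  IsOPair-unique {p} {p′} h h′ = extensionality p p′
    (∈⇒IsSet (proj₁ (proj₂ (IsOPair-member h)))) (∈⇒IsSet (proj₁ (proj₂ (IsOPair-member h′))))
    λ w → ↔-trans (h w) (↔-sym (h′ w))

  -- The singleton of `a` belongs to `p`, so it is the doubleton of `c, c` or of `c, d`; either way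
  -- it contains `c`. Once the first coordinates agree, each second coordinate equals the other one
  -- or the common first coordinate, and equality follows in every case.
  IsOPair-injective : ∀ {p a b c d} → IsOPair U p a b → IsOPair U p c d → (a ≡ c) × (b ≡ d)
  IsOPair-injective {p} {a} {b} {c} {d} h h′ = a≡c , b≡d a≡c
    where
    a≡c : a ≡ c
    a≡c with pairing a a
    ... | s , _ , hs with proj₁ (h′ s) (proj₂ (h s) (inj₁ hs))
    ... | inj₁ k = [ sym , sym ] (proj₁ (hs c) (proj₂ (k c) (inj₁ refl)))
    ... | inj₂ k = [ sym , sym ] (proj₁ (hs c) (proj₂ (k c) (inj₁ refl)))

    second : ∀ {b d} → IsOPair U p a b → IsOPair U p a d → (d ≡ a) ⊎ (d ≡ b)
    second {b} {d} h h′ with IsOPair-member h′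
    ... | s , s∈p , hs with proj₁ (h s) s∈p | proj₂ (hs d) (inj₂ refl)
    ... | inj₁ k | d∈s = [ inj₁ , inj₁ ] (proj₁ (k d) d∈s)
    ... | inj₂ k | d∈s = proj₁ (k d) d∈s

    b≡d : a ≡ c → b ≡ d
    b≡d refl with second h h′ | second h′ h
    ... | inj₂ d≡b | _        = sym d≡b
    ... | inj₁ _   | inj₂ b≡d = b≡d
    ... | inj₁ d≡a | inj₁ b≡a = trans b≡a (sym d≡a)

  -- Definable functions

  abstract
    -- Where `Q y` has no witness the default value is `y` itself. For functional `Q` the graph is
    -- then definable by cases: `Q y a`, or no witness exists and `a ≡ y`.
    the : (M → M → Set) → M → M
    the Q y with em {∃ (Q y)}
    ... | yes (a , _) = a
    ... | no _        = y

    the-spec : ∀ (Q : M → M → Set) {y} → ∃ (Q y) → Q y (the Q y)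
    the-spec Q {y} e with em {∃ (Q y)}
    ... | yes (a , q) = q
    ... | no ne       = ⊥-elim (ne e)

    the-junk : ∀ (Q : M → M → Set) {y} → ¬ ∃ (Q y) → the Q y ≡ y
    the-junk Q {y} ne with em {∃ (Q y)}
    ... | yes e = ⊥-elim (ne e)
    ... | no _  = refl

  Functional : (M → M → Set) → Set
  Functional Q = ∀ y a b → Q y a → Q y b → a ≡ b

  theᵗ : ∀ {k} (Q : M → M → Set) → Functional Q →
         (∀ {k} → Def {suc (suc k)} (λ w → Q (proj₂ (proj₁ w)) (proj₂ w))) →
         Tm {suc k} (λ w → the Q (proj₂ w))
  theᵗ Q fun d = tm (Def-resp (λ w → to w , from w)
      (d ∨ᵈ (¬ᵈ definedᵈ ∧ᵈ v0 ≡ᵈ v1)))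
    where
    definedᵈ : ∀ {k} → Def {suc (suc k)} (λ w → ∃ (Q (proj₂ (proj₁ w))))
    definedᵈ = ∃ᵈ (subst₂ᵈ {P = Q} d v2 v0)
    to : ∀ w → Q (proj₂ (proj₁ w)) (proj₂ w) ⊎ (¬ ∃ (Q (proj₂ (proj₁ w)))) × (proj₂ w ≡ proj₂ (proj₁ w)) →
         proj₂ w ≡ the Q (proj₂ (proj₁ w))
    to ((_ , y) , a) (inj₁ q) = fun y a (the Q y) q (the-spec Q (a , q))
    to ((_ , y) , a) (inj₂ (ne , e)) = trans e (sym (the-junk Q ne))
    from : ∀ w → proj₂ w ≡ the Q (proj₂ (proj₁ w)) →
           Q (proj₂ (proj₁ w)) (proj₂ w) ⊎ (¬ ∃ (Q (proj₂ (proj₁ w)))) × (proj₂ w ≡ proj₂ (proj₁ w))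
    from ((_ , y) , a) refl with em {∃ (Q y)}
    ... | yes e = inj₁ (the-spec Q e)
    ... | no ne = inj₂ (ne , the-junk Q ne)

  abstract
    -- The context is ordered with `x` as its newest entry, because `env` sends that entry to
    -- variable 0 and the scheme evaluates its formula at `x ∷ y ∷ ρ`.
    Replacementᵈ : (P : M → M → Set) → Def {2} (λ w → P (proj₂ w) (proj₂ (proj₁ w))) → ∀ w →
                   (∀ x → x ∈ w → ∃ λ y → P x y × (∀ y′ → P x y′ → y′ ≡ y)) →
                   ∃ λ v → ∀ x → x ∈ w → ∃ λ y → (y ∈ v) × P x y
    Replacementᵈ P d w h = map₂ (λ k x x∈w → map₂ (map₂ (proj₁ (correct d ((tt , _) , x)))) (k x x∈w))
      (replacement (formula d) (params d) w λ x x∈w → let (y , p , u) = h x x∈w in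
        y , proj₂ (correct d ((tt , y) , x)) p , λ y′ p′ → u y′ (proj₁ (correct d ((tt , y′) , x)) p′))

    Collectionᵈ : Collection U → (P : M → M → Set) → Def {2} (λ w → P (proj₂ w) (proj₂ (proj₁ w))) → ∀ w →
                  (∀ x → x ∈ w → ∃ λ y → P x y) → ∃ λ v → ∀ x → x ∈ w → ∃ λ y → (y ∈ v) × P x y
    Collectionᵈ coll P d w h = map₂ (λ k x x∈w → map₂ (map₂ (proj₁ (correct d ((tt , _) , x)))) (k x x∈w))
      (coll (formula d) (params d) w λ x x∈w → map₂ (proj₂ (correct d ((tt , _) , x))) (h x x∈w))

    -- Replacement yields a `V` that includes all pairs of `y` with `f y` but possibly more.
    -- Separation then cuts it down to exactly these pairs, which makes `g` single-valued.
    graphOn : (f : M → M) → (∀ {k} → Tm {suc k} (λ w → f (proj₂ w))) → ∀ x →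
              ∃ λ g → IsFunctionOn U g x × (∀ {y} → y ∈ x → RelHolds U g y (f y))
    graphOn f t x
      with V , hV ← Replacementᵈ (λ y p → IsOPair U p y (f y)) (IsOPairᵈ v1 v0 t) x
                      (λ y _ → let (p , hp) = opair y (f y) in p , hp , λ p′ hp′ → IsOPair-unique hp′ hp)
      with g , sg , hg ← comprehension (λ p → ∃ λ y → (y ∈ x) × IsOPair U p y (f y))
                           (∃ᵈ (v0 ∈ᵈ con x ∧ᵈ IsOPairᵈ v1 v0 t)) V
      = g , (sg , pairs , total , single) , rel
      where
      rel : ∀ {y} → y ∈ x → RelHolds U g y (f y)
      rel {y} y∈x with hV y y∈x
      ... | p , p∈V , hp = p , proj₂ (hg p) (p∈V , y , y∈x , hp) , hp
      pairs : ∀ p → p ∈ g → ∃ λ a → ∃ λ b → (a ∈ x) × IsOPair U p a b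
      pairs p p∈g with proj₂ (proj₁ (hg p) p∈g)
      ... | y , y∈x , hp = y , f y , y∈x , hp
      total : ∀ a → a ∈ x → ∃ λ b → RelHolds U g a b
      total a a∈x = f a , rel a∈x
      value : ∀ {a b} → RelHolds U g a b → b ≡ f a
      value (p , p∈g , hp) with proj₂ (proj₁ (hg p) p∈g)
      ... | y , _ , hp′ with IsOPair-injective hp hp′
      ... | refl , e = e
      single : ∀ a b c → RelHolds U g a b → RelHolds U g a c → b ≡ c
      single a b c r r′ = trans (value r) (sym (value r′))

  Function : M → Set
  Function x = Σ M λ f → IsFunctionOn U f x

  app : ∀ {x} → Function x → M → M
  app (f , _) = the (RelHolds U f)

  appᵗ : ∀ {x} (f : Function x) → ∀ {k} → Tm {suc k} (λ w → app f (proj₂ w))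
  appᵗ (f , _ , _ , _ , fun) = theᵗ (RelHolds U f) fun (RelHoldsᵈ (con f) v1 v0)

  app-rel : ∀ {x} (f : Function x) {y} → y ∈ x → RelHolds U (proj₁ f) y (app f y)
  app-rel (f , _ , _ , tot , _) y∈x = the-spec (RelHolds U f) (tot _ y∈x)

  app-unique : ∀ {x} (f : Function x) {y b} → RelHolds U (proj₁ f) y b → b ≡ app f y
  app-unique (f , _ , _ , _ , fun) r = fun _ _ _ r (the-spec (RelHolds U f) (_ , r))

  mkFunction : (f : M → M) → (∀ {k} → Tm {suc k} (λ w → f (proj₂ w))) → ∀ x →
               Σ (Function x) λ g → ∀ {y} → y ∈ x → app g y ≡ f y
  mkFunction f t x with g , hg , rel ← graphOn f t x =
    (g , hg) , λ y∈x → sym (app-unique (g , hg) (rel y∈x))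

  -- Well-orders

  module WellOrder {r w : M} (wo : WellOrders U r w) where

    infix 4 _≺_ _≼_

    _≺_ : M → M → Set
    a ≺ b = RelHolds U r a b

    _≼_ : M → M → Set
    a ≼ b = (a ≡ b) ⊎ (a ≺ b)

    _≺ᵈ_ : ∀ {k} {f g : Env k → M} → Tm f → Tm g → Def (λ v → f v ≺ g v)
    s ≺ᵈ t = RelHoldsᵈ (con r) s t

    _≼ᵈ_ : ∀ {k} {f g : Env k → M} → Tm f → Tm g → Def (λ v → f v ≼ g v)
    s ≼ᵈ t = s ≡ᵈ t ∨ᵈ s ≺ᵈ t

    irrefl : ∀ {a} → a ∈ w → ¬ (a ≺ a)
    irrefl a∈w = proj₁ wo _ a∈w

    ≺-trans : ∀ {a b c} → a ∈ w → b ∈ w → c ∈ w → a ≺ b → b ≺ c → a ≺ c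
    ≺-trans = proj₁ (proj₂ wo) _ _ _

    ≼-≺-trans : ∀ {a b c} → a ∈ w → b ∈ w → c ∈ w → a ≼ b → b ≺ c → a ≺ c
    ≼-≺-trans a∈w b∈w c∈w (inj₁ refl) q = q
    ≼-≺-trans a∈w b∈w c∈w (inj₂ p)    q = ≺-trans a∈w b∈w c∈w p q

    ≼-trans : ∀ {a b c} → a ∈ w → b ∈ w → c ∈ w → a ≼ b → b ≼ c → a ≼ c
    ≼-trans a∈w b∈w c∈w p (inj₁ refl) = p
    ≼-trans a∈w b∈w c∈w p (inj₂ q)    = inj₂ (≼-≺-trans a∈w b∈w c∈w p q)

    connected : ∀ {a b} → a ∈ w → b ∈ w → (a ≺ b) ⊎ (a ≡ b) ⊎ (b ≺ a)
    connected = proj₁ (proj₂ (proj₂ wo)) _ _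

    ≼-total : ∀ {a b} → a ∈ w → b ∈ w → (a ≼ b) ⊎ (b ≼ a)
    ≼-total a∈w b∈w with connected a∈w b∈w
    ... | inj₁ p          = inj₁ (inj₂ p)
    ... | inj₂ (inj₁ e)   = inj₁ (inj₁ e)
    ... | inj₂ (inj₂ p)   = inj₂ (inj₂ p)

    least : (P : M → Set) → Def {1} (λ v → P (proj₂ v)) → (∃ λ a → (a ∈ w) × P a) →
            ∃ λ m → (m ∈ w) × P m × (∀ z → z ∈ w → P z → ¬ (z ≺ m))
    least P d (a , a∈w , p)
      with s , _ , hs ← comprehension P d w
      with m , m∈s , min ← proj₂ (proj₂ (proj₂ wo)) s (λ z z∈s → proj₁ (proj₁ (hs z) z∈s)) (a , proj₂ (hs a) (a∈w , p))
      with m∈w , q ← proj₁ (hs m) m∈s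
      = m , m∈w , q , λ z z∈w pz → min z (proj₂ (hs z) (z∈w , pz))

    -- A least counterexample exists because `P` is definable, and it contradicts `step`.
    induction : (P : M → Set) → Def {1} (λ v → P (proj₂ v)) →
                (∀ a → a ∈ w → (∀ b → b ∈ w → b ≺ a → P b) → P a) → ∀ a → a ∈ w → P a
    induction P d step a a∈w = dne λ np →
      let (m , m∈w , nq , min) = least (λ z → ¬ P z) (¬ᵈ d) (a , a∈w , np) in
      nq (step m m∈w λ b b∈w b≺m → dne λ nb → min b b∈w nb b≺m)

  -- Choice well-orders sets, whereas the objects in Collection may be urelements. Truth is written
  -- `⊥ → ⊥`, as the formulas have no constant for it.
  toSet : ∀ a → ∃ λ c → IsSet U c × (∀ z → (z ∈ c) ↔ (z ∈ a))
  toSet a with c , sc , h ← comprehension (λ _ → ⊥ → ⊥) (⊥ᵈ ⇒ᵈ ⊥ᵈ) a =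
    c , sc , λ z → proj₁ ∘ proj₁ (h z) , λ z∈a → proj₂ (h z) (z∈a , id)

  -- Quantifying over `k` allows the relation to be used beneath any number of further variables.
  Definable₂ : (M → M → Set) → Set
  Definable₂ P = ∀ {k} → Def {suc (suc k)} (λ w → P (proj₂ (proj₁ w)) (proj₂ w))

  -- Collection is applied on `x′`, the part of `x` where witnesses exist. Taking the least witness
  -- in `v′` makes the selection functional, hence a definable function that can be turned into a
  -- set; elsewhere `the` supplies its default.
  choiceFunction : Collection U → (P : M → M → Set) → Definable₂ P → ∀ x →
                   ∃ λ (g : Function x) → ∀ {y} → y ∈ x → ∃ (P y) → P y (app g y)
  choiceFunction coll P d x
    with x′ , _ , hx ← comprehension (λ y → ∃ (P y)) (∃ᵈ d) x
    with v , hv ← Collectionᵈ coll P (subst₂ᵈ {P = P} d v0 v1) x′ (λ y y∈x′ → proj₂ (proj₁ (hx y) y∈x′))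
    with v′ , sv , hv′ ← toSet v
    with r , wo ← choice v′ sv
    = select , chosen
    where
    open WellOrder wo

    Q : M → M → Set
    Q y a = (a ∈ v′) × P y a × (∀ b → b ∈ v′ → P y b → ¬ (b ≺ a))

    Qᵈ : Definable₂ Q
    Qᵈ = v0 ∈ᵈ con v′ ∧ᵈ d ∧ᵈ ∀ᵈ (v0 ∈ᵈ con v′ ⇒ᵈ subst₂ᵈ {P = P} d v2 v0 ⇒ᵈ ¬ᵈ (v0 ≺ᵈ v1))

    Q-functional : Functional Q
    Q-functional y a b (a∈v , p , a-min) (b∈v , q , b-min) with connected a∈v b∈v
    ... | inj₁ a≺b        = ⊥-elim (b-min a a∈v p a≺b)
    ... | inj₂ (inj₁ e)   = e
    ... | inj₂ (inj₂ b≺a) = ⊥-elim (a-min b b∈v q b≺a)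

    Q-total : ∀ {y} → y ∈ x → ∃ (P y) → ∃ (Q y)
    Q-total {y} y∈x e with a , a∈v , p ← hv y (proj₂ (hx y) (y∈x , e))
      = least (P y) (subst₂ᵈ {P = P} d (con y) v0) (a , proj₂ (hv′ a) a∈v , p)

    select : Function x
    select = proj₁ (mkFunction (the Q) (theᵗ Q Q-functional Qᵈ) x)

    chosen : ∀ {y} → y ∈ x → ∃ (P y) → P y (app select y)
    chosen {y} y∈x e = subst (P y) (sym (proj₂ (mkFunction (the Q) (theᵗ Q Q-functional Qᵈ) x) y∈x))
      (proj₁ (proj₂ (the-spec Q (Q-total y∈x e))))

  -- Internal ultrapowers

  module Ultrapower {F x : M} (uf : IsUltrafilterOn U F x) where

    InF-cong : {P Q : M → Set} → (∀ {y} → y ∈ x → P y ↔ Q y) → InF U F x P ↔ InF U F x Q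
    InF-cong e = (λ (s , s∈F , h) → s , s∈F , λ y → ↔-trans (h y) (under e))
               , (λ (s , s∈F , h) → s , s∈F , λ y → ↔-trans (h y) (under (↔-sym ∘ e)))
      where
      under : ∀ {A B C : Set} → (A → B ↔ C) → (A × B) ↔ (A × C)
      under e = (λ (a , b) → a , proj₁ (e a) b) , (λ (a , c) → a , proj₂ (e a) c)

    InF-all : {P : M → Set} → (∀ {y} → y ∈ x → P y) → InF U F x P
    InF-all p = x , proj₁ (proj₂ uf) , λ y → (λ y∈x → y∈x , p y∈x) , proj₁

    -- The set for `P` comes with the hypothesis; the one for `Q` has to be separated from `x`, and
    -- lies in `F` as a superset.
    InF-mono : {P Q : M → Set} → Def {1} (λ w → Q (proj₂ w)) →
               (∀ {y} → y ∈ x → P y → Q y) → InF U F x P → InF U F x Q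
    InF-mono {Q = Q} d p⇒q (s , s∈F , hs) with t , st , ht ← comprehension Q d x =
      t , proj₁ (proj₂ (proj₂ (proj₂ (proj₂ uf)))) s t s∈F st (λ z → proj₁ ∘ proj₁ (ht z))
            (λ z z∈s → let (z∈x , p) = proj₁ (hs z) z∈s in proj₂ (ht z) (z∈x , p⇒q z∈x p))
        , ht

    InF-× : {P Q : M → Set} → InF U F x P → InF U F x Q → InF U F x (λ y → P y × Q y)
    InF-× (s , s∈F , hs) (t , t∈F , ht) with u , su , hu ← comprehension (_∈ t) (v0 ∈ᵈ con t) s =
      u , proj₁ (proj₂ (proj₂ (proj₂ uf))) s t u s∈F t∈F su hu
        , λ y → ↔-trans (hu y) (↔-trans (∧-cong (hs y) (ht y))
            ((λ ((y∈x , p) , _ , q) → y∈x , p , q) , (λ (y∈x , p , q) → (y∈x , p) , y∈x , q)))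

    InF-inhabited : {P : M → Set} → InF U F x P → ∃ λ y → (y ∈ x) × P y
    InF-inhabited (s , s∈F , hs) with z , z∈s ← proj₁ (proj₂ (proj₂ uf)) s s∈F = z , proj₁ (hs z) z∈s

    -- Left to right is the ultrafilter dichotomy. Conversely, the sets for `P` and its negation
    -- would meet in a member of `F`, and members of `F` are inhabited.
    InF-¬ : {P : M → Set} → Def {1} (λ w → P (proj₂ w)) → (¬ InF U F x P) ↔ InF U F x (λ y → ¬ P y)
    InF-¬ {P} d = to , λ n p → let (_ , _ , q , nq) = InF-inhabited (InF-× p n) in nq q
      where
      to : ¬ InF U F x P → InF U F x (λ y → ¬ P y)
      to n with s , ss , hs ← comprehension P d x
        with proj₂ (proj₂ (proj₂ (proj₂ (proj₂ uf)))) s ss (λ z → proj₁ ∘ proj₁ (hs z))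
      ... | inj₁ s∈F = ⊥-elim (n (s , s∈F , hs))
      ... | inj₂ k with t , st , ht ← comprehension (λ z → ¬ (z ∈ s)) (¬ᵈ (v0 ∈ᵈ con s)) x =
        t , k t st ht , λ y → ↔-trans (ht y)
          ( (λ (y∈x , y∉s) → y∈x , λ p → y∉s (proj₂ (hs y) (y∈x , p)))
          , (λ (y∈x , np) → y∈x , λ y∈s → np (proj₂ (proj₁ (hs y) y∈s))))

    val : ∀ {n} → (Fin n → Function x) → M → Fin n → M
    val ρ y i = app (ρ i) y

    val-∷ : ∀ {n} (φ : Formula (suc n)) g (ρ : Fin n → Function x) {y} →
            Sat S φ (val (g ∷ ρ) y) ↔ Sat S φ (app g y ∷ val ρ y)
    val-∷ φ g ρ = Sat-cong S φ λ { zero → refl ; (suc i) → refl }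

    Holds : ∀ {n} → Formula n → (Fin n → Function x) → Set
    Holds φ ρ = InF U F x λ y → Sat S φ (val ρ y)

    Sat-valᵈ : ∀ {n k} (φ : Formula n) (ρ : Fin n → Function x) → Def {suc k} (λ w → Sat S φ (val ρ (proj₂ w)))
    Sat-valᵈ φ ρ = Satᵈ φ (λ i w → app (ρ i) (proj₂ w)) (λ i → appᵗ (ρ i))

    Sat-val-∷ᵈ : ∀ {n} (φ : Formula (suc n)) (ρ : Fin n → Function x) → Definable₂ (λ y a → Sat S φ (a ∷ val ρ y))
    Sat-val-∷ᵈ φ ρ = Satᵈ φ (λ i w → (proj₂ w ∷ val ρ (proj₂ (proj₁ w))) i)
      λ { zero → v0 ; (suc i) → wk (appᵗ (ρ i)) }

    -- At `y ∈ x` the tuple `b` is forced to be `val ρ y`, since each `ρ i` is total on `x` and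
    -- single-valued.
    Holds⇔InF : ∀ {n} (φ : Formula n) (ρ : Fin n → Function x) →
                Holds φ ρ ↔ InF U F x (λ y → ∃ λ (b : Fin n → M) →
                  (∀ i → RelHolds U (proj₁ (ρ i)) y (b i)) × Sat S φ b)
    Holds⇔InF φ ρ = InF-cong λ {y} y∈x →
        (λ p → val ρ y , (λ i → app-rel (ρ i) y∈x) , p)
      , (λ (b , rel , p) → proj₁ (Sat-cong S φ λ i → app-unique (ρ i) (rel i)) p)

    Ult-∈ : (g f : Function x) → Structure._∈_ (Ult U F x) g f ↔ InF U F x (λ y → app g y ∈ app f y)
    Ult-∈ g f = InF-cong λ y∈x →
        (λ (b , c , rb , rc , b∈c) → subst (_ ∈_) (app-unique f rc) (subst (_∈ c) (app-unique g rb) b∈c))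
      , (λ p → _ , _ , app-rel g y∈x , app-rel f y∈x , p)

    Ult-≈ : (f g : Function x) → Structure._≈_ (Ult U F x) f g ↔ InF U F x (λ y → app f y ≡ app g y)
    Ult-≈ f g = InF-cong λ {y} y∈x →
        (λ (b , rb , rb′) → trans (sym (app-unique f rb)) (app-unique g rb′))
      , (λ p → _ , app-rel f y∈x , subst (RelHolds U (proj₁ g) y) (sym p) (app-rel g y∈x))

    Ult-𝒜 : (f : Function x) → Structure.𝒜 (Ult U F x) f ↔ InF U F x (λ y → 𝒜 (app f y))
    Ult-𝒜 f = InF-cong λ y∈x →
        (λ (b , rb , p) → subst 𝒜 (app-unique f rb) p)
      , (λ p → _ , app-rel f y∈x , p)

    -- Trades a witness at each coordinate for one element of the ultrapower. This is where
    -- Collection enters the Łoś theorem.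
    uniformize : Collection U → ∀ {n} (φ : Formula (suc n)) (ρ : Fin n → Function x) →
                 ∃ λ g → ∀ {y} → y ∈ x → ∃ (λ a → Sat S φ (a ∷ val ρ y)) → Sat S φ (val (g ∷ ρ) y)
    uniformize coll φ ρ =
      let (g , wit) = choiceFunction coll (λ y a → Sat S φ (a ∷ val ρ y)) (Sat-val-∷ᵈ φ ρ) x in
      g , λ y∈x e → proj₂ (val-∷ φ g ρ) (wit y∈x e)

    Łoś : Collection U → ∀ {n} (φ : Formula n) (ρ : Fin n → Function x) → Sat (Ult U F x) φ ρ ↔ Holds φ ρ
    Łoś coll (meṁ i j) ρ = Ult-∈ (ρ i) (ρ j)
    Łoś coll (eq̇ i j)  ρ = Ult-≈ (ρ i) (ρ j)
    Łoś coll (uṙ i)    ρ = Ult-𝒜 (ρ i)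
    Łoś coll ⊥̇         ρ = (λ ()) , λ p → proj₂ (proj₂ (InF-inhabited p))
    Łoś coll (¬̇ φ)     ρ = ↔-trans (⇒-cong (Łoś coll φ ρ) (id , id)) (InF-¬ (Sat-valᵈ φ ρ))
    Łoś coll (φ ∧̇ ψ)   ρ = ↔-trans (∧-cong (Łoś coll φ ρ) (Łoś coll ψ ρ))
      ( (λ (p , q) → InF-× p q)
      , (λ p → InF-mono (Sat-valᵈ φ ρ) (λ _ → proj₁) p , InF-mono (Sat-valᵈ ψ ρ) (λ _ → proj₂) p))
    Łoś coll (φ ∨̇ ψ)   ρ = ↔-trans (∨-cong (Łoś coll φ ρ) (Łoś coll ψ ρ)) (to , from)
      where
      to : Holds φ ρ ⊎ Holds ψ ρ → Holds (φ ∨̇ ψ) ρ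
      to = [ InF-mono (Sat-valᵈ (φ ∨̇ ψ) ρ) (λ _ → inj₁) , InF-mono (Sat-valᵈ (φ ∨̇ ψ) ρ) (λ _ → inj₂) ]
      from : Holds (φ ∨̇ ψ) ρ → Holds φ ρ ⊎ Holds ψ ρ
      from p with em {Holds φ ρ}
      ... | yes q = inj₁ q
      ... | no nq = inj₂ (InF-mono (Sat-valᵈ ψ ρ) (λ _ (d , n) → [ ⊥-elim ∘ n , id ] d)
                      (InF-× p (proj₁ (InF-¬ (Sat-valᵈ φ ρ)) nq)))
    Łoś coll (φ ⇒̇ ψ)   ρ = ↔-trans (⇒-cong (Łoś coll φ ρ) (Łoś coll ψ ρ)) (to , from)
      where
      to : (Holds φ ρ → Holds ψ ρ) → Holds (φ ⇒̇ ψ) ρ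
      to h with em {Holds φ ρ}
      ... | yes q = InF-mono (Sat-valᵈ (φ ⇒̇ ψ) ρ) (λ _ r _ → r) (h q)
      ... | no nq = InF-mono (Sat-valᵈ (φ ⇒̇ ψ) ρ) (λ _ n p → ⊥-elim (n p)) (proj₁ (InF-¬ (Sat-valᵈ φ ρ)) nq)
      from : Holds (φ ⇒̇ ψ) ρ → Holds φ ρ → Holds ψ ρ
      from h p = InF-mono (Sat-valᵈ ψ ρ) (λ _ (f , q) → f q) (InF-× h p)
    Łoś coll (∀̇ φ)     ρ = ↔-trans (∀-cong λ g → Łoś coll φ (g ∷ ρ)) (to , from)
      where
      to : (∀ g → Holds φ (g ∷ ρ)) → Holds (∀̇ φ) ρ
      -- Here `g` picks a counterexample to `φ` wherever there is one. If `φ` holds of `g` almost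
      -- everywhere, then almost everywhere no counterexample exists.
      to h = let (g , wit) = uniformize coll (¬̇ φ) ρ in
        InF-mono (Sat-valᵈ (∀̇ φ) ρ) (λ y∈x p a → dne λ n → wit y∈x (a , n) p) (h g)
      from : Holds (∀̇ φ) ρ → ∀ g → Holds φ (g ∷ ρ)
      from h g = InF-mono (Sat-valᵈ φ (g ∷ ρ)) (λ _ p → proj₂ (val-∷ φ g ρ) (p _)) h
    Łoś coll (∃̇ φ)     ρ = ↔-trans (∃-cong λ g → Łoś coll φ (g ∷ ρ)) (to , from)
      where
      to : (∃ λ g → Holds φ (g ∷ ρ)) → Holds (∃̇ φ) ρ
      to (g , h) = InF-mono (Sat-valᵈ (∃̇ φ) ρ) (λ _ p → _ , proj₁ (val-∷ φ g ρ) p) h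
      from : Holds (∃̇ φ) ρ → ∃ λ g → Holds φ (g ∷ ρ)
      from h = let (g , wit) = uniformize coll φ ρ in g , InF-mono (Sat-valᵈ φ (g ∷ ρ)) wit h

  collection⇒Łoś : Collection U → LosForAllInternalUltrapowers U
  collection⇒Łoś coll F x uf φ ρ = mk⇔ (proj₁ e) (proj₂ e)
    where
    open Ultrapower uf
    e = ↔-trans (Łoś coll φ ρ) (Holds⇔InF φ ρ)

  -- Recursion along a well-order

  module Recursion {r w : M} (wo : WellOrders U r w) where
    open WellOrder wo

    module _ (C : M → M → Set) (Cᵈ : Definable₂ C)
             (local : ∀ {G G′ b} → b ∈ w → (∀ c → c ∈ w → c ≺ b → (c ∈ G) ↔ (c ∈ G′)) → C G b → C G′ b) where

      private
        local↔ : ∀ {G G′ b} → b ∈ w → (∀ c → c ∈ w → c ≺ b → (c ∈ G) ↔ (c ∈ G′)) → C G b ↔ C G′ b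
        local↔ b∈w e = local b∈w e , local b∈w λ c c∈w c≺b → ↔-sym (e c c∈w c≺b)

        CorrectUpTo : M → M → Set
        CorrectUpTo a G = ∀ b → b ∈ w → b ≼ a → (b ∈ G) ↔ C G b

        CorrectUpToᵈ : Definable₂ CorrectUpTo
        CorrectUpToᵈ = ∀ᵈ (v0 ∈ᵈ con w ⇒ᵈ v0 ≼ᵈ v2 ⇒ᵈ ((v0 ∈ᵈ v1) ⇔ᵈ subst₂ᵈ {P = C} Cᵈ v1 v0))

        agree : ∀ {a a′ G G′} → a ∈ w → a′ ∈ w → CorrectUpTo a G → CorrectUpTo a′ G′ →
                ∀ b → b ∈ w → b ≼ a → b ≼ a′ → (b ∈ G) ↔ (b ∈ G′)
        agree {a} {a′} {G} {G′} a∈w a′∈w k k′ = induction (λ b → b ≼ a → b ≼ a′ → (b ∈ G) ↔ (b ∈ G′))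
          (v0 ≼ᵈ con a ⇒ᵈ v0 ≼ᵈ con a′ ⇒ᵈ ((v0 ∈ᵈ con G) ⇔ᵈ (v0 ∈ᵈ con G′)))
          λ b b∈w ih p p′ → ↔-trans (k b b∈w p) (↔-trans
            (local↔ b∈w λ c c∈w c≺b →
              ih c c∈w c≺b (≼-trans c∈w b∈w a∈w (inj₂ c≺b) p) (≼-trans c∈w b∈w a′∈w (inj₂ c≺b) p′))
            (↔-sym (k′ b b∈w p′)))

      -- `F` consists of the `a` that belong to some approximation correct up to `a`. By `agree`,
      -- any two approximations coincide on their common range, so `F` matches each of them there.
      recursion : ∃ λ F → ∀ b → b ∈ w → (b ∈ F) ↔ C F b
      recursion
        with F , _ , hF ← comprehension (λ a → ∃ λ G → CorrectUpTo a G × (a ∈ G))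
                            (∃ᵈ (CorrectUpToᵈ ∧ᵈ v1 ∈ᵈ v0)) w
        = F , λ b b∈w → F-correct b∈w (exists b b∈w)
        where
        F-agrees : ∀ {a G} → a ∈ w → CorrectUpTo a G → ∀ b → b ∈ w → b ≼ a → (b ∈ F) ↔ (b ∈ G)
        F-agrees {a} {G} a∈w k b b∈w b≼a =
            (λ b∈F → let (_ , G′ , k′ , b∈G′) = proj₁ (hF b) b∈F in
              proj₁ (agree b∈w a∈w k′ k b b∈w (inj₁ refl) b≼a) b∈G′)
          , (λ b∈G → proj₂ (hF b) (b∈w , G , (λ c c∈w c≼b → k c c∈w (≼-trans c∈w b∈w a∈w c≼b b≼a)) , b∈G))

        F-correct : ∀ {b} → b ∈ w → ∃ (CorrectUpTo b) → (b ∈ F) ↔ C F b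
        F-correct {b} b∈w (G , k) = ↔-trans (F-agrees b∈w k b b∈w (inj₁ refl)) (↔-trans (k b b∈w (inj₁ refl))
          (local↔ b∈w λ c c∈w c≺b → ↔-sym (F-agrees b∈w k c c∈w (inj₂ c≺b))))

        extend : ∀ a → a ∈ w → (∀ b → b ∈ w → b ≺ a → ∃ (CorrectUpTo b)) → ∃ (CorrectUpTo a)
        extend a a∈w ih
          -- The approximation at `a` is `F` below `a`, where `F` is already correct by `ih`, with
          -- `a` added exactly when `C F a` holds.
          with G , _ , hG ← comprehension (λ b → (b ≺ a) × (b ∈ F) ⊎ (b ≡ a) × C F a)
                              ((v0 ≺ᵈ con a ∧ᵈ v0 ∈ᵈ con F) ∨ᵈ
                               (v0 ≡ᵈ con a ∧ᵈ subst₂ᵈ {P = C} Cᵈ (con F) (con a))) w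
          = G , correctUpTo
          where
          below : ∀ c → c ∈ w → c ≺ a → (c ∈ F) ↔ (c ∈ G)
          below c c∈w c≺a =
              (λ c∈F → proj₂ (hG c) (c∈w , inj₁ (c≺a , c∈F)))
            , (λ c∈G → [ proj₂ , (λ { (refl , _) → ⊥-elim (irrefl a∈w c≺a) }) ] (proj₂ (proj₁ (hG c) c∈G)))
          correctUpTo : CorrectUpTo a G
          correctUpTo b _ (inj₁ refl) = ↔-trans
            ( (λ b∈G → [ (λ (b≺b , _) → ⊥-elim (irrefl a∈w b≺b)) , proj₂ ] (proj₂ (proj₁ (hG b) b∈G)))
            , (λ p → proj₂ (hG b) (a∈w , inj₂ (refl , p))))
            (local↔ a∈w below)
          correctUpTo b b∈w (inj₂ b≺a) = ↔-trans (↔-sym (below b b∈w b≺a)) (↔-trans (F-correct b∈w (ih b b∈w b≺a))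
            (local↔ b∈w λ c c∈w c≺b → below c c∈w (≺-trans c∈w b∈w a∈w c≺b b≺a)))

        exists : ∀ a → a ∈ w → ∃ (CorrectUpTo a)
        exists = induction (λ a → ∃ (CorrectUpTo a)) (∃ᵈ CorrectUpToᵈ) extend

  -- Every filter extends to an ultrafilter

  -- These are the first five clauses of `IsUltrafilterOn`; `ultra` will supply the sixth.
  IsFilterOn : M → M → Set
  IsFilterOn F x =
      (∀ s → s ∈ F → IsSet U s × SubsetOf U s x)
    × (x ∈ F)
    × (∀ s → s ∈ F → ∃ λ z → z ∈ s)
    × (∀ s t u → s ∈ F → t ∈ F → IsSet U u →
         (∀ z → (z ∈ u) ↔ ((z ∈ s) × (z ∈ t))) → u ∈ F)
    × (∀ s t → s ∈ F → IsSet U t → SubsetOf U t x → SubsetOf U s t → t ∈ F)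

  abstract
    IsFilterOnᵈ : ∀ {k} {f g : Env k → M} → Tm f → Tm g → Def (λ v → IsFilterOn (f v) (g v))
    IsFilterOnᵈ s t =
         ∀ᵈ (v0 ∈ᵈ wk s ⇒ᵈ IsSetᵈ v0 ∧ᵈ SubsetOfᵈ v0 (wk t))
      ∧ᵈ t ∈ᵈ s
      ∧ᵈ ∀ᵈ (v0 ∈ᵈ wk s ⇒ᵈ ∃ᵈ (v0 ∈ᵈ v1))
      ∧ᵈ ∀ᵈ (∀ᵈ (∀ᵈ (v2 ∈ᵈ wk (wk (wk s)) ⇒ᵈ v1 ∈ᵈ wk (wk (wk s)) ⇒ᵈ IsSetᵈ v0 ⇒ᵈ
           ∀ᵈ ((v0 ∈ᵈ v1) ⇔ᵈ (v0 ∈ᵈ wk v2 ∧ᵈ v0 ∈ᵈ v2)) ⇒ᵈ v0 ∈ᵈ wk (wk (wk s)))))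
      ∧ᵈ ∀ᵈ (∀ᵈ (v1 ∈ᵈ wk (wk s) ⇒ᵈ IsSetᵈ v0 ⇒ᵈ SubsetOfᵈ v0 (wk (wk t)) ⇒ᵈ SubsetOfᵈ v1 v0 ⇒ᵈ
           v0 ∈ᵈ wk (wk s)))

  module UltrafilterLemma {T x : M} (T-filter : IsFilterOn T x) where

    abstract
      W : M
      W = proj₁ (powerset x)

      W-spec : ∀ s → (s ∈ W) ↔ (IsSet U s × SubsetOf U s x)
      W-spec = proj₂ (proj₂ (powerset x))

      r : M
      r = proj₁ (choice W (proj₁ (proj₂ (powerset x))))

      W-wellOrdered : WellOrders U r W
      W-wellOrdered = proj₂ (choice W (proj₁ (proj₂ (powerset x))))

    open WellOrder W-wellOrdered

    Admissible : M → M → Set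
    Admissible G b = ∃ λ Φ → IsFilterOn Φ x × SubsetOf U T Φ ×
      (∀ c → c ∈ W → c ≺ b → c ∈ G → c ∈ Φ) × (b ∈ Φ)

    Admissibleᵈ : Definable₂ Admissible
    Admissibleᵈ = ∃ᵈ (IsFilterOnᵈ v0 (con x) ∧ᵈ SubsetOfᵈ (con T) v0 ∧ᵈ
      ∀ᵈ (v0 ∈ᵈ con W ⇒ᵈ v0 ≺ᵈ v2 ⇒ᵈ v0 ∈ᵈ wk v2 ⇒ᵈ v0 ∈ᵈ v1) ∧ᵈ v1 ∈ᵈ v0)

    Admissible-local : ∀ {H H′ b} → b ∈ W → (∀ c → c ∈ W → c ≺ b → (c ∈ H) ↔ (c ∈ H′)) →
                       Admissible H b → Admissible H′ b
    Admissible-local _ e (Φ , f , T⊆Φ , h , b∈Φ) =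
      Φ , f , T⊆Φ , (λ c c∈W c≺b c∈H′ → h c c∈W c≺b (proj₂ (e c c∈W c≺b) c∈H′)) , b∈Φ

    abstract
      G : M
      G = proj₁ (Recursion.recursion W-wellOrdered Admissible Admissibleᵈ Admissible-local)

      G-spec : ∀ b → b ∈ W → (b ∈ G) ↔ Admissible G b
      G-spec = proj₂ (Recursion.recursion W-wellOrdered Admissible Admissibleᵈ Admissible-local)

    -- Such a `Φ` witnesses that the sets accepted up to and including `c` are jointly consistent
    -- with `T`.
    Above : M → M → Set
    Above c Φ = IsFilterOn Φ x × SubsetOf U T Φ × (∀ d → d ∈ W → d ≼ c → d ∈ G → d ∈ Φ)

    Aboveᵈ : Definable₂ Above
    Aboveᵈ = IsFilterOnᵈ v0 (con x) ∧ᵈ SubsetOfᵈ (con T) v0 ∧ᵈ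
      ∀ᵈ (v0 ∈ᵈ con W ⇒ᵈ v0 ≼ᵈ v2 ⇒ᵈ v0 ∈ᵈ con G ⇒ᵈ v0 ∈ᵈ v1)

    Above-mono : ∀ {c d Φ} → c ∈ W → d ∈ W → c ≼ d → Above d Φ → Above c Φ
    Above-mono c∈W d∈W c≼d (f , T⊆Φ , h) = f , T⊆Φ , λ e e∈W e≼c → h e e∈W (≼-trans e∈W c∈W d∈W e≼c c≼d)

    -- No filter is chosen for each `c`. Instead `Φ` is the union over `c ∈ I` of the intersection
    -- of all filters above `c`; by `Above-mono` these intersections grow with `c`, so the union is
    -- closed under meets. For empty `I` the filter `T` serves.
    directedUnion : ∀ I → SubsetOf U I W → (∀ c → c ∈ I → ∃ (Above c)) →
                    ∃ λ Φ → IsFilterOn Φ x × SubsetOf U T Φ × (∀ c → c ∈ I → c ∈ G → c ∈ Φ)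
    directedUnion I I⊆W above with em {∃ λ c → c ∈ I}
    ... | no empty = T , T-filter , (λ _ → id) , λ c c∈I → ⊥-elim (empty (c , c∈I))
    ... | yes (c₀ , c₀∈I) =
        Φ , (subsets , member x (c₀ , c₀∈I , λ Ψ (f , _) → proj₁ (proj₂ f)) , inhabited , meet , upward)
          , (λ s s∈T → member s (c₀ , c₀∈I , λ Ψ (_ , T⊆Ψ , _) → T⊆Ψ s s∈T))
          , (λ c c∈I c∈G → member c (c , c∈I , λ Ψ (_ , _ , h) → h c (I⊆W c c∈I) (inj₁ refl) c∈G))
      where
      Φ-comprehension = comprehension (λ s → ∃ λ c → (c ∈ I) × (∀ Φ → Above c Φ → s ∈ Φ))
             (∃ᵈ (v0 ∈ᵈ con I ∧ᵈ ∀ᵈ (subst₂ᵈ {P = Above} Aboveᵈ v1 v0 ⇒ᵈ v2 ∈ᵈ v0))) W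
      Φ = proj₁ Φ-comprehension
      hΦ = proj₂ (proj₂ Φ-comprehension)
      subsets : ∀ s → s ∈ Φ → IsSet U s × SubsetOf U s x
      subsets s s∈Φ = proj₁ (W-spec s) (proj₁ (proj₁ (hΦ s) s∈Φ))
      member : ∀ s → (∃ λ c → (c ∈ I) × (∀ Ψ → Above c Ψ → s ∈ Ψ)) → s ∈ Φ
      member s p@(c , c∈I , h) = let (Ψ , a@(f , _)) = above c c∈I in
        proj₂ (hΦ s) (proj₂ (W-spec s) (proj₁ f s (h Ψ a)) , p)
      inhabited : ∀ s → s ∈ Φ → ∃ λ z → z ∈ s
      inhabited s s∈Φ = let (_ , c , c∈I , h) = proj₁ (hΦ s) s∈Φ ; (Ψ , a@(f , _)) = above c c∈I in
        proj₁ (proj₂ (proj₂ f)) s (h Ψ a)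
      meet : ∀ s t u → s ∈ Φ → t ∈ Φ → IsSet U u → (∀ z → (z ∈ u) ↔ ((z ∈ s) × (z ∈ t))) → u ∈ Φ
      meet s t u s∈Φ t∈Φ su hu with proj₁ (hΦ s) s∈Φ | proj₁ (hΦ t) t∈Φ
      ... | _ , c , c∈I , h | _ , d , d∈I , k with ≼-total (I⊆W c c∈I) (I⊆W d d∈I)
      ... | inj₁ c≼d = member u (d , d∈I , λ Ψ a → proj₁ (proj₂ (proj₂ (proj₂ (proj₁ a)))) s t u
              (h Ψ (Above-mono (I⊆W c c∈I) (I⊆W d d∈I) c≼d a)) (k Ψ a) su hu)
      ... | inj₂ d≼c = member u (c , c∈I , λ Ψ a → proj₁ (proj₂ (proj₂ (proj₂ (proj₁ a)))) s t u
              (h Ψ a) (k Ψ (Above-mono (I⊆W d d∈I) (I⊆W c c∈I) d≼c a)) su hu)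
      upward : ∀ s t → s ∈ Φ → IsSet U t → SubsetOf U t x → SubsetOf U s t → t ∈ Φ
      upward s t s∈Φ st t⊆x s⊆t = let (_ , c , c∈I , h) = proj₁ (hΦ s) s∈Φ in
        member t (c , c∈I , λ Ψ a → proj₂ (proj₂ (proj₂ (proj₂ (proj₁ a)))) s t (h Ψ a) st t⊆x s⊆t)

    -- An accepted `a` brings its own filter through `Admissible`. A rejected `a` adds no
    -- requirement, so the filters of its predecessors are merged.
    bounded-step : ∀ a → a ∈ W → (∀ b → b ∈ W → b ≺ a → ∃ (Above b)) → ∃ (Above a)
    bounded-step a a∈W ih with em {a ∈ G}
    ... | yes a∈G = let (Φ , f , T⊆Φ , h , a∈Φ) = proj₁ (G-spec a a∈W) a∈G in
      Φ , f , T⊆Φ , λ { d _ (inj₁ refl) _ → a∈Φ ; d d∈W (inj₂ d≺a) d∈G → h d d∈W d≺a d∈G }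
    ... | no a∉G =
      let (I , _ , hI) = comprehension (_≺ a) (v0 ≺ᵈ con a) W
          (Φ , f , T⊆Φ , h) = directedUnion I (λ z z∈I → proj₁ (proj₁ (hI z) z∈I))
            (λ c c∈I → let (c∈W , c≺a) = proj₁ (hI c) c∈I in ih c c∈W c≺a)
      in Φ , f , T⊆Φ , λ { d _ (inj₁ refl) d∈G → ⊥-elim (a∉G d∈G)
                         ; d d∈W (inj₂ d≺a) → h d (proj₂ (hI d) (d∈W , d≺a)) }

    bounded : ∀ a → a ∈ W → ∃ (Above a)
    bounded = induction (λ a → ∃ (Above a)) (∃ᵈ Aboveᵈ) bounded-step

    module _ {Φ : M} (Φ-filter : IsFilterOn Φ x) (T⊆Φ : SubsetOf U T Φ)
             (G⊆Φ : ∀ c → c ∈ W → c ∈ G → c ∈ Φ) where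

      private
        subsets = proj₁ Φ-filter
        x∈Φ     = proj₁ (proj₂ Φ-filter)
        meet    = proj₁ (proj₂ (proj₂ (proj₂ Φ-filter)))
        upward  = proj₂ (proj₂ (proj₂ (proj₂ Φ-filter)))

      -- The larger filter `Ψ` itself shows that `s` is admissible, so the recursion accepted `s`.
      maximal : ∀ {Ψ s} → IsFilterOn Ψ x → SubsetOf U Φ Ψ → s ∈ W → s ∈ Ψ → s ∈ Φ
      maximal {Ψ} {s} g Φ⊆Ψ s∈W s∈Ψ = G⊆Φ s s∈W (proj₂ (G-spec s s∈W)
        (Ψ , g , (λ z z∈T → Φ⊆Ψ z (T⊆Φ z z∈T)) , (λ c c∈W _ c∈G → Φ⊆Ψ c (G⊆Φ c c∈W c∈G)) , s∈Ψ))

      ultra : ∀ s → IsSet U s → SubsetOf U s x →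
              (s ∈ Φ) ⊎ (∀ t → IsSet U t → (∀ z → (z ∈ t) ↔ ((z ∈ x) × ¬ (z ∈ s))) → t ∈ Φ)
      ultra s ss s⊆x with em {∃ λ v → (v ∈ Φ) × (∀ z → z ∈ v → ¬ (z ∈ s))}
      ... | yes (v , v∈Φ , disjoint) = inj₂ λ t st ht → upward v t v∈Φ st (λ z → proj₁ ∘ proj₁ (ht z))
              (λ z z∈v → proj₂ (ht z) (proj₂ (subsets v v∈Φ) z z∈v , disjoint z z∈v))
      ... | no meets
        = inj₁ (maximal (subsets′ , Φ⊆Ψ x x∈Φ , inhabited′ , meet′ , upward′) Φ⊆Ψ s∈W
                  (proj₂ (hΨ s) (s∈W , x , x∈Φ , λ _ _ → id)))
        where
        -- `Ψ` is the filter generated by `Φ` and `s`. It is proper because every member of `Φ`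
        -- meets `s`.
        Ψ-comprehension = comprehension (λ u → ∃ λ v → (v ∈ Φ) × (∀ z → z ∈ v → z ∈ s → z ∈ u))
          (∃ᵈ (v0 ∈ᵈ con Φ ∧ᵈ ∀ᵈ (v0 ∈ᵈ v1 ⇒ᵈ v0 ∈ᵈ con s ⇒ᵈ v0 ∈ᵈ v2))) W
        Ψ = proj₁ Ψ-comprehension
        hΨ = proj₂ (proj₂ Ψ-comprehension)
        s∈W : s ∈ W
        s∈W = proj₂ (W-spec s) (ss , s⊆x)
        Φ⊆Ψ : SubsetOf U Φ Ψ
        Φ⊆Ψ u u∈Φ = proj₂ (hΨ u) (proj₂ (W-spec u) (subsets u u∈Φ) , u , u∈Φ , λ _ z∈u _ → z∈u)
        subsets′ : ∀ u → u ∈ Ψ → IsSet U u × SubsetOf U u x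
        subsets′ u u∈Ψ = proj₁ (W-spec u) (proj₁ (proj₁ (hΨ u) u∈Ψ))
        inhabited′ : ∀ u → u ∈ Ψ → ∃ λ z → z ∈ u
        inhabited′ u u∈Ψ = let (_ , v , v∈Φ , h) = proj₁ (hΨ u) u∈Ψ in
          dne λ empty → meets (v , v∈Φ , λ z z∈v z∈s → empty (z , h z z∈v z∈s))
        meet′ : ∀ u u′ i → u ∈ Ψ → u′ ∈ Ψ → IsSet U i → (∀ z → (z ∈ i) ↔ ((z ∈ u) × (z ∈ u′))) → i ∈ Ψ
        meet′ u u′ i u∈Ψ u′∈Ψ si hi =
          let (_ , v , v∈Φ , h) = proj₁ (hΨ u) u∈Ψ
              (_ , v′ , v′∈Φ , h′) = proj₁ (hΨ u′) u′∈Ψ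
              (j , sj , hj) = comprehension (_∈ v′) (v0 ∈ᵈ con v′) v
          in proj₂ (hΨ i)
              ( proj₂ (W-spec i) (si , λ z z∈i → proj₂ (subsets′ u u∈Ψ) z (proj₁ (proj₁ (hi z) z∈i)))
              , j , meet v v′ j v∈Φ v′∈Φ sj hj
              , λ z z∈j z∈s → let (z∈v , z∈v′) = proj₁ (hj z) z∈j in
                  proj₂ (hi z) (h z z∈v z∈s , h′ z z∈v′ z∈s))
        upward′ : ∀ u t → u ∈ Ψ → IsSet U t → SubsetOf U t x → SubsetOf U u t → t ∈ Ψ
        upward′ u t u∈Ψ st t⊆x u⊆t = let (_ , v , v∈Φ , h) = proj₁ (hΨ u) u∈Ψ in
          proj₂ (hΨ t) (proj₂ (W-spec t) (st , t⊆x) , v , v∈Φ , λ z z∈v z∈s → u⊆t z (h z z∈v z∈s))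

    ultrafilter : ∃ λ F → IsUltrafilterOn U F x × SubsetOf U T F
    ultrafilter =
      let (Φ , f@(subsets , x∈Φ , inhabited , meet , upward) , T⊆Φ , G⊆Φ) = directedUnion W (λ _ → id) bounded
      in Φ , (subsets , x∈Φ , inhabited , meet , upward , ultra f T⊆Φ G⊆Φ) , T⊆Φ

  -- Collection from Łoś

  -- The sets containing a tail form a filter: tails are nested by totality of the order, and each
  -- contains its starting point. Inhabitedness of `x` puts `x` itself into this filter.
  tailUltrafilter : ∀ {r w} (wo : WellOrders U r w) → let open WellOrder wo in
    ∀ x → SubsetOf U x w → (∃ λ a → a ∈ x) →
    ∃ λ F → IsUltrafilterOn U F x × (∀ b → b ∈ x → InF U F x (b ≼_))
  tailUltrafilter {r} {w} wo x x⊆w (a , a∈x) =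
    let (F , uf , T⊆F) = UltrafilterLemma.ultrafilter (subsets , x∈T , inhabited , meet , upward) in
    F , uf , λ b b∈x → let (s , ss , hs) = comprehension (b ≼_) (con b ≼ᵈ v0) x in
      s , T⊆F s (member ss (λ z → proj₁ ∘ proj₁ (hs z)) (b , b∈x , λ c c∈x b≼c → proj₂ (hs c) (c∈x , b≼c))) , hs
    where
    open WellOrder wo
    ContainsTail : M → Set
    ContainsTail s = ∃ λ b → (b ∈ x) × (∀ c → c ∈ x → b ≼ c → c ∈ s)
    Px = powerset x
    T-comprehension = comprehension ContainsTail
      (∃ᵈ (v0 ∈ᵈ con x ∧ᵈ ∀ᵈ (v0 ∈ᵈ con x ⇒ᵈ v1 ≼ᵈ v0 ⇒ᵈ v0 ∈ᵈ v2))) (proj₁ Px)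
    T = proj₁ T-comprehension
    hT = proj₂ (proj₂ T-comprehension)
    member : ∀ {s} → IsSet U s → SubsetOf U s x → ContainsTail s → s ∈ T
    member {s} ss s⊆x t = proj₂ (hT s) (proj₂ (proj₂ (proj₂ Px) s) (ss , s⊆x) , t)
    subsets : ∀ s → s ∈ T → IsSet U s × SubsetOf U s x
    subsets s s∈T = proj₁ (proj₂ (proj₂ Px) s) (proj₁ (proj₁ (hT s) s∈T))
    x∈T : x ∈ T
    x∈T = member (∈⇒IsSet a∈x) (λ _ → id) (a , a∈x , λ c c∈x _ → c∈x)
    inhabited : ∀ s → s ∈ T → ∃ λ z → z ∈ s
    inhabited s s∈T = let (_ , b , b∈x , h) = proj₁ (hT s) s∈T in b , h b b∈x (inj₁ refl)
    meet : ∀ s t u → s ∈ T → t ∈ T → IsSet U u → (∀ z → (z ∈ u) ↔ ((z ∈ s) × (z ∈ t))) → u ∈ T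
    meet s t u s∈T t∈T su hu = member su (λ z z∈u → proj₂ (subsets s s∈T) z (proj₁ (proj₁ (hu z) z∈u))) tail
      where
      tail : ContainsTail u
      tail with proj₂ (proj₁ (hT s) s∈T) | proj₂ (proj₁ (hT t) t∈T)
      ... | b , b∈x , h | d , d∈x , k with ≼-total (x⊆w b b∈x) (x⊆w d d∈x)
      ... | inj₁ b≼d = d , d∈x , λ c c∈x d≼c → proj₂ (hu c)
        (h c c∈x (≼-trans (x⊆w b b∈x) (x⊆w d d∈x) (x⊆w c c∈x) b≼d d≼c) , k c c∈x d≼c)
      ... | inj₂ d≼b = b , b∈x , λ c c∈x b≼c → proj₂ (hu c)
        (h c c∈x b≼c , k c c∈x (≼-trans (x⊆w d d∈x) (x⊆w b b∈x) (x⊆w c c∈x) d≼b b≼c))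
    upward : ∀ s t → s ∈ T → IsSet U t → SubsetOf U t x → SubsetOf U s t → t ∈ T
    upward s t s∈T st t⊆x s⊆t = let (_ , b , b∈x , h) = proj₁ (hT s) s∈T in
      member st t⊆x (b , b∈x , λ c c∈x b≼c → s⊆t c (h c c∈x b≼c))

  -- The existential formula is true at every coordinate, so Łoś makes it true in the ultrapower.
  -- There it has a witness `g`, and Łoś for `ψ` translates this back to almost every coordinate.
  Łoś-witness : LosForAllInternalUltrapowers U → ∀ {F x} → IsUltrafilterOn U F x →
                (P : M → M → Set) → Definable₂ P → (∀ {y} → y ∈ x → ∃ (P y)) →
                ∃ λ (g : Function x) → InF U F x (λ y → P y (app g y))
  Łoś-witness los {F} {x} uf P d total =
    let (g , ult) = Equivalence.from (los F x uf (∃̇ ψ) ρ) (proj₁ (Holds⇔InF (∃̇ ψ) ρ) (InF-all satisfied)) in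
    g , proj₁ (InF-cong λ {y} y∈x → ↔-trans
          (Sat-cong S ψ λ { zero → refl ; (suc i) → val-ρ y∈x i }) (correct d₀ ((tt , y) , app g y)))
        (proj₂ (Holds⇔InF ψ (g ∷ ρ)) (Equivalence.to (los F x uf ψ (g ∷ ρ)) ult))
    where
    open Ultrapower uf
    d₀ = d {zero}
    ψ  = formula d₀
    identity = mkFunction id v0 x
    constant : ∀ a → Σ (Function x) λ g → ∀ {y} → y ∈ x → app g y ≡ a
    constant a = mkFunction (λ _ → a) (con a) x
    ρ : Fin (suc (arity d₀)) → Function x
    -- The identity function represents the varying `y`; constant functions represent the parameters
    -- of `ψ`.
    ρ = proj₁ identity ∷ λ i → proj₁ (constant (params d₀ i))
    val-ρ : ∀ {y} → y ∈ x → ∀ i → val ρ y i ≡ (y ∷ params d₀) i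
    val-ρ y∈x zero    = proj₂ identity y∈x
    val-ρ y∈x (suc i) = proj₂ (constant (params d₀ i)) y∈x
    satisfied : ∀ {y} → y ∈ x → Sat S (∃̇ ψ) (val ρ y)
    satisfied {y} y∈x = let (a , p) = total y∈x in
      proj₂ (Sat-cong S (∃̇ ψ) (val-ρ y∈x)) (a , proj₂ (correct d₀ ((tt , y) , a)) p)

  -- With Kuratowski pairs, each value b of g is a member of a member of a pair in g, hence b ⊆ ⋃⋃⋃g.
  valuesUnion : ∀ {x} (g : Function x) → ∃ λ v → ∀ {y c} → y ∈ x → c ∈ app g y → c ∈ v
  valuesUnion g =
    let (v₁ , _ , h₁) = union (proj₁ g) ; (v₂ , _ , h₂) = union v₁ ; (v₃ , _ , h₃) = union v₂ in
    v₃ , λ {y} {c} y∈x c∈b →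
      let (p , p∈g , hp) = app-rel g y∈x ; (s , s∈p , hs) = IsOPair-member hp in
      proj₂ (h₃ c) (_ , proj₂ (h₂ _) (s , proj₂ (h₁ s) (p , p∈g , s∈p) , proj₂ (hs _) (inj₂ refl)) , c∈b)

  adjoin : ∀ v y → ∃ λ v′ → SubsetOf U v v′ × (y ∈ v′)
  adjoin v y =
    let (s , _ , hs) = pairing y y ; (p , _ , hp) = pairing v s ; (v′ , _ , h) = union p in
    v′ , (λ z z∈v → proj₂ (h z) (v , proj₂ (hp v) (inj₁ refl) , z∈v))
       , proj₂ (h y) (s , proj₂ (hp s) (inj₂ refl) , proj₂ (hs y) (inj₁ refl))

  module _ (los : LosForAllInternalUltrapowers U) (R : M → M → Set) (Rᵈ : Definable₂ R)
           {r w : M} (wo : WellOrders U r w) (total : ∀ x → x ∈ w → ∃ (R x)) where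
    open WellOrder wo

    CollectsUpTo : M → M → Set
    CollectsUpTo b v = ∀ c → c ∈ w → c ≼ b → ∃ λ y → (y ∈ v) × R c y

    CollectsUpToᵈ : Definable₂ CollectsUpTo
    CollectsUpToᵈ = ∀ᵈ (v0 ∈ᵈ con w ⇒ᵈ v0 ≼ᵈ v2 ⇒ᵈ ∃ᵈ (v0 ∈ᵈ v2 ∧ᵈ subst₂ᵈ {P = R} Rᵈ v1 v0))

    -- If g represents a witness of "some v collects R up to b" at b = [id], then the union of the
    -- values of g collects R on all of x, because every c ∈ x lies below F-almost every b.
    collectsOn : ∀ x → SubsetOf U x w → (∀ b → b ∈ x → ∃ (CollectsUpTo b)) →
                 ∃ λ v → ∀ c → c ∈ x → ∃ λ y → (y ∈ v) × R c y
    collectsOn x x⊆w below with em {∃ λ a → a ∈ x}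
    -- The empty set carries no ultrafilter, and there any `v` collects vacuously.
    ... | no empty = x , λ c c∈x → ⊥-elim (empty (c , c∈x))
    ... | yes nonempty =
      let (F , uf , tails) = tailUltrafilter wo x x⊆w nonempty
          (g , collects)   = Łoś-witness los uf CollectsUpTo CollectsUpToᵈ (λ {b} → below b)
          (v , values⊆v)   = valuesUnion g
          open Ultrapower uf
      in v , λ c c∈x →
        let (b , b∈x , c≼b , h) = InF-inhabited (InF-× (tails c c∈x) collects)
            (y , y∈gb , ry)     = h c (x⊆w c c∈x) c≼b
        in y , values⊆v b∈x y∈gb , ry

    -- The ultrapower argument handles the strict predecessors of `b`; one witness for `b` itself is
    -- then adjoined.
    collectsUpTo : ∀ b → b ∈ w → ∃ (CollectsUpTo b)
    collectsUpTo = induction (λ b → ∃ (CollectsUpTo b)) (∃ᵈ CollectsUpToᵈ) λ b b∈w ih →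
      let (x , _ , hx) = comprehension (_≺ b) (v0 ≺ᵈ con b) w
          (v , hv) = collectsOn x (λ c c∈x → proj₁ (proj₁ (hx c) c∈x))
                       (λ c c∈x → let (c∈w , c≺b) = proj₁ (hx c) c∈x in ih c c∈w c≺b)
          (y , ry) = total b b∈w
          (v′ , v⊆v′ , y∈v′) = adjoin v y
      in v′ , λ { c _ (inj₁ refl)   → y , y∈v′ , ry
                ; c c∈w (inj₂ c≺b) → let (z , z∈v , rz) = hv c (proj₂ (hx c) (c∈w , c≺b)) in
                                     z , v⊆v′ z z∈v , rz }

    -- `collectsUpTo` gives a separate set for each `b`. A last ultrapower, over all of `w`, merges
    -- them, which also covers a `w` without a greatest element.
    collects : ∃ λ v → ∀ c → c ∈ w → ∃ λ y → (y ∈ v) × R c y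
    collects = collectsOn w (λ _ → id) collectsUpTo

  Łoś⇒collection : LosForAllInternalUltrapowers U → Collection U
  Łoś⇒collection los {n} φ ρ w h =
    let (w′ , sw , hw) = toSet w
        (r , wo) = choice w′ sw
        (v , hv) = collects los R Rᵈ wo (λ x x∈w′ → h x (proj₁ (hw x) x∈w′))
    in v , λ x x∈w → hv x (proj₂ (hw x) x∈w)
    where
    R : M → M → Set
    R x y = Sat S φ (x ∷ y ∷ ρ)
    Rᵈ : Definable₂ R
    Rᵈ = Satᵈ φ (λ i u → (proj₂ (proj₁ u) ∷ proj₂ u ∷ ρ) i)
      λ { zero → v1 ; (suc zero) → v0 ; (suc (suc i)) → con (ρ i) }

theorem2p19 : ExcludedMiddle 0ℓ → (U : UStructure) → IsZFCUR U →
    LosForAllInternalUltrapowers U ⇔ Collection U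
theorem2p19 em U Z = mk⇔ (SetTheory.Łoś⇒collection em U Z) (SetTheory.collection⇒Łoś em U Z)
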